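{- Let $d$ be a positive integer. There is a bijection between the set of $d$-dimensional strongly stable partitions and the set of $d$-dimensional totally symmetric partitions which preserves the side length $n$ of the minimal $d$-dimensional box containing the partition. That is, there is a bijection $f$ from the first set to the second such that, for every $n$, $f$ restricts to a bijection $\tilde{\mathcal{B}}_d(n)\to\tilde{\mathcal{T}}_d(n)$.
   Context: Let $\mathbb{N}=\{0,1,2,\dots\}$. A $d$-dimensional partition is a finite subset $P\subset\mathbb{N}^d$ such that $(a_1,\dots,a_j,\dots,a_d)\in P$ implies $(a_1,\dots,a_j-1,\dots,a_d)\in P$ for all $1\le j\le d$ with $a_j>0$; its elements are called cells. For a cell $\alpha=(a_1,\dots,a_d)\in P$, the $j$th arm length $h_j$ is the largest integer such that $(a_1,\dots,a_j+h_j,\dots,a_d)\in P$, and $H(\alpha)=(h_1,\dots,h_d)$ is the Hook vector of $\alpha$. A partition $P$ is strongly stable if for every cell $\alpha\in P$ the Hook vector is weakly increasing: $h_1\le h_2\le\cdots\le h_d$. A partition $P$ is totally symmetric if $\alpha\in P$ implies $\pi(\alpha)\in P$ for all $\pi\in S_d$, where $S_d$ acts on $\mathbb{N}^d$ by permuting coordinates. All boxes have all $d$ sides of equal length: the box of side length $n$ is $\{0,1,\dots,n-1\}^d$. $\mathcal{P}_d(n)$ denotes the set of $d$-dimensional partitions whose largest coordinate of any cell equals $n-1$, i.e. those whose minimal containing box has side length $n$ (by convention the empty partition has minimal box of side length $0$). $\tilde{\mathcal{B}}_d(n)$ is the set of strongly stable partitions in $\mathcal{P}_d(n)$, and $\tilde{\mathcal{T}}_d(n)$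 is the set of totally symmetric partitions in $\mathcal{P}_d(n)$. -}

module Defs where

open import Data.Fin.Base using (Fin)
open import Data.Fin.Permutation using (Permutation′; _⟨$⟩ʳ_)
open import Data.List.Base using (List)
open import Data.List.Membership.Propositional using (_∈_)
open import Data.List.Relation.Binary.BagAndSetEquality using ([_]-Equality; set)
open import Data.Nat.Base using (ℕ; _+_; pred; _≤_; _<_)
open import Data.Product.Base using (Σ; ∃; _×_; proj₁)
open import Data.Vec.Base using (Vec; lookup; tabulate; updateAt)
open import Data.Vec.Relation.Unary.All using (All)
open import Data.Vec.Relation.Unary.Linked using (Linked)
open import Level using (0ℓ)
open import Relation.Binary.Bundles using (Setoid)
import Relation.Binary.Construct.On as On
open import Relation.Unary using (Pred; _∩_)

Cell : ℕ → Set
Cell d = Vec ℕ d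

-- A finite subset of ℕ^d is given by a list of its elements.  Order and
-- repetitions are irrelevant: equality of partitions is Partitionₛ below.
record Partition (d : ℕ) : Set where
  field
    cells      : List (Cell d)
    downClosed : ∀ {α} → α ∈ cells → (j : Fin d) → 0 < lookup α j →
                 updateAt α j pred ∈ cells

open Partition public

Partitionₛ : ℕ → Setoid 0ℓ 0ℓ
Partitionₛ d = On.setoid ([ set ]-Equality (Cell d)) (cells {d})

infix 4 _∈ₚ_

_∈ₚ_ : ∀ {d} → Cell d → Partition d → Set
α ∈ₚ P = α ∈ cells P

-- For α ∈ P the value h = 0 always qualifies, so the largest such integer is
-- a natural number; it exists because P is finite.
IsArmLength : ∀ {d} → Partition d → Cell d → Fin d → ℕ → Set
IsArmLength P α j h =
  updateAt α j (_+ h) ∈ₚ P × (∀ k → updateAt α j (_+ k) ∈ₚ P → k ≤ h)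

IsHookVector : ∀ {d} → Partition d → Cell d → Vec ℕ d → Set
IsHookVector {d} P α H = (j : Fin d) → IsArmLength P α j (lookup H j)

-- The hook vector of a cell is unique, so ∃ here says "the hook vector".
StronglyStable : ∀ {d} → Pred (Partition d) 0ℓ
StronglyStable P = ∀ {α} → α ∈ₚ P → ∃ λ H → IsHookVector P α H × Linked _≤_ H

permute : ∀ {d} → Permutation′ d → Cell d → Cell d
permute π α = tabulate (λ i → lookup α (π ⟨$⟩ʳ i))

TotallySymmetric : ∀ {d} → Pred (Partition d) 0ℓ
TotallySymmetric {d} P = ∀ {α} → α ∈ₚ P → (π : Permutation′ d) → permute π α ∈ₚ P

Box : ∀ {d} → ℕ → Pred (Cell d) 0ℓ
Box n = All (_< n)

_FitsIn_ : ∀ {d} → Partition d → ℕ → Set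
P FitsIn n = ∀ {α} → α ∈ₚ P → Box n α

-- The minimal box containing P has side length n: for n > 0 the largest
-- coordinate of a cell is n ∸ 1, and the empty partition has n = 0.
MinimalBox : ∀ {d} → ℕ → Pred (Partition d) 0ℓ
MinimalBox n P = P FitsIn n × (∀ m → P FitsIn m → n ≤ m)

subsetoid : ∀ {d} → Pred (Partition d) 0ℓ → Setoid 0ℓ 0ℓ
subsetoid {d} Q = On.setoid {B = Σ (Partition d) Q} (Partitionₛ d) proj₁

StronglyStableₛ TotallySymmetricₛ : ℕ → Setoid 0ℓ 0ℓ
StronglyStableₛ   d = subsetoid {d} StronglyStable
TotallySymmetricₛ d = subsetoid {d} TotallySymmetric

B̃ T̃ : (d n : ℕ) → Setoid 0ℓ 0ℓ
B̃ d n = subsetoid {d} (StronglyStable ∩ MinimalBox n)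
T̃ d n = subsetoid {d} (TotallySymmetric ∩ MinimalBox n)

{-# OPTIONS --safe #-}

-- A totally symmetric partition T is determined by its weakly increasing
-- cells, and such a cell is the sequence of partial sums of its differences.
-- Let P be the set of differences of the increasing cells of T.  Lowering one
-- entry of an increasing cell without destroying monotonicity moves a unit of
-- the difference vector from entry i to entry i + 1 (or drops it from the last
-- entry), so P is closed under these Borel moves, and any Borel-closed P arises.
-- Borel closure is strong stability: if α ∈ P and the i-th arm of α is h, then
-- moving h units from i to i + 1 shows that the (i+1)-st arm is at least h;
-- conversely a single move of β is possible because 1 ≤ h_i ≤ h_{i+1} at the
-- cell β − e_i.  Moving everything to the last entry shows that the largest entry
-- of a cell of P is the largest partial sum, so minimal boxes agree.
module Submission where

open import Defs
open import Data.Fin.Base using (Fin; zero; suc; punchIn)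
open import Data.Fin.Permutation as Perm
  using (Permutation′; _⟨$⟩ʳ_; _∘ₚ_; flip; lift₀; transpose; remove; punchIn-permute)
open import Data.Fin.Properties using (punchOut-punchIn; punchInᵢ≢i)
open import Data.List.Base as List using (List; upTo; cartesianProductWith; filter)
open import Data.List.Membership.Propositional using (_∈_)
open import Data.List.Membership.Propositional.Properties
  using (∈-cartesianProductWith⁺; ∈-filter⁺; ∈-filter⁻; ∈-upTo⁺)
open import Data.List.Relation.Unary.Any using (here; there)
open import Data.Nat.Base
  using (ℕ; NonZero; zero; suc; pred; _+_; _∸_; _⊓_; _⊔_; _≤_; _<_; _≤′_; z≤n; z<s; >-nonZero; ≤′-refl; ≤′-step)
open import Data.Nat.Properties
open import Data.Product.Base using (Σ-syntax; ∃; _×_; _,_; proj₁; proj₂; map₂)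
open import Data.Sum.Base using (inj₁; inj₂)
open import Data.Vec.Base using (Vec; []; _∷_; lookup; tabulate; updateAt; removeAt)
open import Data.Vec.Properties
  using (≡-dec; lookup∘tabulate; lookup∘updateAt; tabulate-cong; tabulate∘lookup; removeAt-punchOut;
         updateAt-id-local; updateAt-updateAt-local)
open import Data.Vec.Relation.Binary.Pointwise.Inductive as Pointwise using (Pointwise; []; _∷_)
open import Data.Vec.Relation.Unary.All as All using (All; []; _∷_)
import Data.Vec.Relation.Unary.All.Properties as All
open import Data.Vec.Relation.Unary.Linked using (Linked; []; [-]; _∷_)
open import Function.Base using (_∘_; _$_; id)
open import Function.Bundles using (Bijection; Equivalence; mk⇔; _⇔_)
open import Level using (0ℓ)
open import Relation.Binary.Bundles using (Setoid)
open import Relation.Binary.Construct.Closure.ReflexiveTransitive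
  using (Star; ε; _◅_; _◅◅_; gmap)
open import Relation.Binary.PropositionalEquality
  using (_≡_; refl; sym; trans; cong; cong₂; subst; subst₂; module ≡-Reasoning)
open import Relation.Nullary.Decidable using (yes; no)
open import Relation.Unary using (Pred; Decidable)

private
  variable
    c c′ d m n x y : ℕ
    α β γ : Cell d
    zs : Vec ℕ n

infix 4 _≤*_ _⋖_ _↘_ _↘*_ _↭_

-- Entrywise order and down-closed predicates

_≤*_ : Cell d → Cell d → Set
_≤*_ = Pointwise _≤_

≤*-refl : α ≤* α
≤*-refl = Pointwise.refl ≤-refl

All-<-≤* : α ≤* β → All (_< m) β → All (_< m) α
All-<-≤* []       []       = []
All-<-≤* (p ∷ ps) (q ∷ qs) = ≤-<-trans p q ∷ All-<-≤* ps qs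

updateAt-pred-≤* : (α : Cell d) (j : Fin d) → updateAt α j pred ≤* α
updateAt-pred-≤* (x ∷ α) zero    = pred[n]≤n ∷ ≤*-refl
updateAt-pred-≤* (x ∷ α) (suc j) = ≤-refl ∷ updateAt-pred-≤* α j

updateAt-mono-≤* : (α : Cell d) (j : Fin d) {f g : ℕ → ℕ} →
                   f (lookup α j) ≤ g (lookup α j) → updateAt α j f ≤* updateAt α j g
updateAt-mono-≤* (x ∷ α) zero    p = p ∷ ≤*-refl
updateAt-mono-≤* (x ∷ α) (suc j) p = ≤-refl ∷ updateAt-mono-≤* α j p

DownClosed : Pred (Cell d) 0ℓ → Set
DownClosed Q = ∀ {α} → Q α → ∀ j → 0 < lookup α j → Q (updateAt α j pred)

-- Lower the head one unit at a time, then recurse on the tail. `Q` is an arbitrary predicate so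
-- that the recursion can fix the head.
downClosed-≤* : (Q : Pred (Cell d) 0ℓ) → DownClosed Q → α ≤* β → Q β → Q α
downClosed-≤* Q dc []       q = q
downClosed-≤* Q dc (_∷_ {x = x} {xs = α} {ys = β} x≤y ps) q =
  downClosed-≤* (λ γ → Q (x ∷ γ)) (λ q j → dc q (suc j)) ps (lower (≤⇒≤′ x≤y) q)
  where
  lower : ∀ {y} → x ≤′ y → Q (y ∷ β) → Q (x ∷ β)
  lower ≤′-refl     q = q
  lower (≤′-step p) q = lower p (dc q zero z<s)

-- Sorting

-- The min/max form makes insert monotone without any sortedness assumption.
insert : ℕ → Cell d → Cell (suc d)
insert x []       = x ∷ []
insert x (z ∷ zs) = x ⊓ z ∷ insert (x ⊔ z) zs

sort : Cell d → Cell d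
sort []      = []
sort (x ∷ α) = insert x (sort α)

insert-mono : x ≤ y → α ≤* β → insert x α ≤* insert y β
insert-mono p []       = p ∷ []
insert-mono p (q ∷ qs) = ⊓-mono-≤ p q ∷ insert-mono (⊔-mono-≤ p q) qs

sort-mono : α ≤* β → sort α ≤* sort β
sort-mono []       = []
sort-mono (p ∷ ps) = insert-mono p (sort-mono ps)

⊓-swap : ∀ x y z → x ⊓ (y ⊓ z) ≡ y ⊓ (x ⊓ z)
⊓-swap x y z = trans (sym (⊓-assoc x y z)) (trans (cong (_⊓ z) (⊓-comm x y)) (⊓-assoc y x z))

insert-comm-≤ : x ≤ y → (zs : Cell d) → insert x (insert y zs) ≡ insert y (insert x zs)
insert-comm-≤ {x} {y} x≤y []
  rewrite ⊓-comm x y | ⊔-comm x y = refl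
insert-comm-≤ {x} {y} x≤y (z ∷ zs) = cong₂ _∷_ (⊓-swap x y z) tails
  where
  tails : insert (x ⊔ (y ⊓ z)) (insert (y ⊔ z) zs) ≡ insert (y ⊔ (x ⊓ z)) (insert (x ⊔ z) zs)
  -- The position of `z` relative to `x ≤ y` resolves every minimum and maximum. The two larger of
  -- the three values remain to be inserted; if `z` is the largest, both sides coincide.
  tails with ≤-total z x | ≤-total z y
  ... | inj₁ z≤x | _
    rewrite m≥n⇒m⊓n≡n z≤x | m≥n⇒m⊔n≡m z≤x
          | m≥n⇒m⊓n≡n (≤-trans z≤x x≤y) | m≥n⇒m⊔n≡m (≤-trans z≤x x≤y)
          | m≥n⇒m⊔n≡m z≤x = insert-comm-≤ x≤y zs
  ... | inj₂ x≤z | inj₁ z≤y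
    rewrite m≤n⇒m⊓n≡m x≤z | m≤n⇒m⊔n≡n x≤z
          | m≥n⇒m⊓n≡n z≤y | m≥n⇒m⊔n≡m z≤y
          | m≤n⇒m⊔n≡n x≤z | m≥n⇒m⊔n≡m x≤y = insert-comm-≤ z≤y zs
  ... | inj₂ x≤z | inj₂ y≤z
    rewrite m≤n⇒m⊓n≡m x≤z | m≤n⇒m⊔n≡n x≤z
          | m≤n⇒m⊓n≡m y≤z | m≤n⇒m⊔n≡n y≤z
          | m≤n⇒m⊔n≡n x≤y | m≥n⇒m⊔n≡m x≤y = refl

insert-comm : ∀ x y (zs : Cell d) → insert x (insert y zs) ≡ insert y (insert x zs)
insert-comm x y zs with ≤-total x y
... | inj₁ x≤y = insert-comm-≤ x≤y zs
... | inj₂ y≤x = sym (insert-comm-≤ y≤x zs)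

-- By `insert-comm`, any entry may be the one inserted last.
sort-removeAt : (α : Cell (suc d)) (i : Fin (suc d)) →
                sort α ≡ insert (lookup α i) (sort (removeAt α i))
sort-removeAt (x ∷ α)     zero    = refl
sort-removeAt (x ∷ y ∷ α) (suc i) =
  trans (cong (insert x) (sort-removeAt (y ∷ α) i))
        (insert-comm x (lookup (y ∷ α) i) (sort (removeAt (y ∷ α) i)))

lookup-punchIn : (α : Cell (suc d)) (i : Fin (suc d)) (j : Fin d) →
                 lookup α (punchIn i j) ≡ lookup (removeAt α i) j
lookup-punchIn α i j =
  trans (sym (removeAt-punchOut α (punchInᵢ≢i i j ∘ sym)))
        (cong (lookup (removeAt α i)) (punchOut-punchIn i))

-- The entry that `π` brings to the front is inserted last on both sides; `remove zero π` permutes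
-- the remaining ones.
sort-permute : (π : Permutation′ d) (α : Cell d) → sort (permute π α) ≡ sort α
sort-permute {zero}  π []  = refl
sort-permute {suc d} π α = begin
  insert (lookup α i) (sort (tabulate (λ j → lookup α (π ⟨$⟩ʳ suc j))))
    ≡⟨ cong (insert (lookup α i) ∘ sort) (tabulate-cong λ j →
         trans (cong (lookup α) (punchIn-permute π zero j)) (lookup-punchIn α i _)) ⟩
  insert (lookup α i) (sort (permute (remove zero π) (removeAt α i)))
    ≡⟨ cong (insert (lookup α i)) (sort-permute (remove zero π) (removeAt α i)) ⟩
  insert (lookup α i) (sort (removeAt α i))
    ≡⟨ sort-removeAt α i ⟨
  sort α ∎
  where
  open ≡-Reasoning
  i = π ⟨$⟩ʳ zero

-- Sorting as a rearrangement into weakly increasing order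

record _↭_ (α β : Cell d) : Set where
  constructor _,_
  field
    permutation : Permutation′ d
    permutes    : permute permutation α ≡ β

permute-∘ : (ρ π : Permutation′ d) (α : Cell d) → permute ρ (permute π α) ≡ permute (ρ ∘ₚ π) α
permute-∘ ρ π α = tabulate-cong λ i → lookup∘tabulate (λ j → lookup α (π ⟨$⟩ʳ j)) (ρ ⟨$⟩ʳ i)

↭-refl : α ↭ α
↭-refl {α = α} = Perm.id , tabulate∘lookup α

↭-trans : α ↭ β → β ↭ γ → α ↭ γ
↭-trans {α = α} (π , refl) (ρ , refl) = ρ ∘ₚ π , sym (permute-∘ ρ π α)

↭-sym : α ↭ β → β ↭ α
↭-sym {α = α} (π , refl) = flip π , (begin
  permute (flip π) (permute π α) ≡⟨ permute-∘ (flip π) π α ⟩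
  permute (flip π ∘ₚ π) α        ≡⟨ tabulate-cong (λ i → cong (lookup α) (Perm.inverseʳ π)) ⟩
  tabulate (lookup α)            ≡⟨ tabulate∘lookup α ⟩
  α                              ∎)
  where open ≡-Reasoning

↭-prep : ∀ x → α ↭ β → x ∷ α ↭ x ∷ β
↭-prep x (π , refl) = lift₀ π , refl

↭-swap : ∀ x y (α : Cell d) → x ∷ y ∷ α ↭ y ∷ x ∷ α
↭-swap x y α = transpose zero (suc zero) , cong (λ β → y ∷ x ∷ β) (tabulate∘lookup α)

↭-⊓⊔ : ∀ x y (α : Cell d) → x ∷ y ∷ α ↭ x ⊓ y ∷ x ⊔ y ∷ α
↭-⊓⊔ x y α with ≤-total x y
... | inj₁ x≤y rewrite m≤n⇒m⊓n≡m x≤y | m≤n⇒m⊔n≡n x≤y = ↭-refl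
... | inj₂ y≤x rewrite m≥n⇒m⊓n≡n y≤x | m≥n⇒m⊔n≡m y≤x = ↭-swap x y α

↭-insert : ∀ x (α : Cell d) → x ∷ α ↭ insert x α
↭-insert x []      = ↭-refl
↭-insert x (z ∷ α) = ↭-trans (↭-⊓⊔ x z α) (↭-prep (x ⊓ z) (↭-insert (x ⊔ z) α))

↭-sort : (α : Cell d) → α ↭ sort α
↭-sort []      = ↭-refl
↭-sort (x ∷ α) = ↭-trans (↭-prep x (↭-sort α)) (↭-insert x (sort α))

All-↭ : {Q : Pred ℕ 0ℓ} → α ↭ β → All Q α → All Q β
All-↭ (π , refl) ps = All.tabulate⁺ (λ i → All.lookup⁺ ps (π ⟨$⟩ʳ i))

-- The lower bound `c` in front links each new head to what precedes it; in the recursive call it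
-- becomes `x ⊓ z`.
insert-sorted : c ≤ x → Linked _≤_ (c ∷ zs) → Linked _≤_ (c ∷ insert x zs)
insert-sorted c≤x [-]       = c≤x ∷ [-]
insert-sorted {x = x} {zs = z ∷ _} c≤x (c≤z ∷ s) =
  ⊓-glb c≤x c≤z ∷ insert-sorted (m⊓n≤m⊔n x z) (relax s)
  where
  relax : ∀ {n} {ws : Vec ℕ n} → Linked _≤_ (z ∷ ws) → Linked _≤_ (x ⊓ z ∷ ws)
  relax [-]     = [-]
  relax (p ∷ s) = ≤-trans (m⊓n≤n x z) p ∷ s

sort-sorted : (α : Cell d) → Linked _≤_ (0 ∷ sort α)
sort-sorted []      = [-]
sort-sorted (x ∷ α) = insert-sorted z≤n (sort-sorted α)

insert-head : (zs : Cell d) → Linked _≤_ (x ∷ zs) → insert x zs ≡ x ∷ zs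
insert-head []       s         = refl
insert-head (z ∷ zs) (x≤z ∷ s)
  rewrite m≤n⇒m⊓n≡m x≤z | m≤n⇒m⊔n≡n x≤z = cong (_ ∷_) (insert-head zs s)

-- Partial sums and differences

sums : ℕ → Cell d → Cell d
sums c []      = []
sums c (x ∷ α) = c + x ∷ sums (c + x) α

-- Truncated subtraction is exact on weakly increasing cells; `SymCell` sorts first for this reason.
diffs : ℕ → Cell d → Cell d
diffs c []      = []
diffs c (x ∷ α) = x ∸ c ∷ diffs x α

diffs∘sums : ∀ c (α : Cell d) → diffs c (sums c α) ≡ α
diffs∘sums c []      = refl
diffs∘sums c (x ∷ α) = cong₂ _∷_ (m+n∸m≡n c x) (diffs∘sums (c + x) α)

sums∘diffs : (α : Cell d) → Linked _≤_ (c ∷ α) → sums c (diffs c α) ≡ α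
sums∘diffs []      s         = refl
sums∘diffs {c = c} (x ∷ α) (c≤x ∷ s)
  rewrite m+[n∸m]≡n c≤x = cong (x ∷_) (sums∘diffs α s)

sums-sorted : ∀ c (α : Cell d) → Linked _≤_ (c ∷ sums c α)
sums-sorted c []      = [-]
sums-sorted c (x ∷ α) = m≤m+n c x ∷ sums-sorted (c + x) α

sums-mono : c ≤ c′ → α ≤* β → sums c α ≤* sums c′ β
sums-mono c≤c′ []       = []
sums-mono c≤c′ (p ∷ ps) = +-mono-≤ c≤c′ p ∷ sums-mono (+-mono-≤ c≤c′ p) ps

≤*-sums : ∀ c (α : Cell d) → α ≤* sums c α
≤*-sums c []      = []
≤*-sums c (x ∷ α) = m≤n+m x c ∷ ≤*-sums (c + x) α

sort∘sums : ∀ c (α : Cell d) → sort (sums c α) ≡ sums c α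
sort∘sums c []      = refl
sort∘sums c (x ∷ α) =
  trans (cong (insert (c + x)) (sort∘sums (c + x) α))
        (insert-head (sums (c + x) α) (sums-sorted (c + x) α))

sums-shift : ∀ c x y k (α : Cell d) →
             sums (c + (x + k)) (y ∷ α) ≡ sums (c + x) (y + k ∷ α)
sums-shift c x y k α = cong (λ s → s ∷ sums s α) (begin
  c + (x + k) + y   ≡⟨ +-assoc c (x + k) y ⟩
  c + (x + k + y)   ≡⟨ cong (c +_) (+-assoc x k y) ⟩
  c + (x + (k + y)) ≡⟨ cong (λ z → c + (x + z)) (+-comm k y) ⟩
  c + (x + (y + k)) ≡⟨ +-assoc c x (y + k) ⟨
  c + x + (y + k)   ∎)
  where open ≡-Reasoning

-- Borel moves

-- The relation j = i + 1, in inductive form so that matching on it exposes the two adjacent entries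
-- of a cell.
data _⋖_ : Fin n → Fin n → Set where
  zero⋖one : zero {suc n} ⋖ suc zero
  suc⋖suc  : {i j : Fin n} → i ⋖ j → suc i ⋖ suc j

-- In partial-sum coordinates, both moves can only decrease entries.
data _↘_ (α : Cell d) : Cell d → Set where
  drop : ∀ {j} → 0 < lookup α j → α ↘ updateAt α j pred
  move : ∀ {i j} → i ⋖ j → 0 < lookup α i → α ↘ updateAt (updateAt α i pred) j suc

_↘*_ : Cell d → Cell d → Set
_↘*_ = Star _↘_

↘-cons : ∀ x → α ↘ β → x ∷ α ↘ x ∷ β
↘-cons x (drop {j} p) = drop {j = suc j} p
↘-cons x (move q p)   = move (suc⋖suc q) p

↘*-cons : ∀ x → α ↘* β → x ∷ α ↘* x ∷ β
↘*-cons x = gmap (x ∷_) (↘-cons x)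

-- The `i`-th partial sum drops by one; all others are unchanged.
sums-antitone-move : ∀ c (α : Cell d) {i j} → i ⋖ j → 0 < lookup α i →
                     sums c (updateAt (updateAt α i pred) j suc) ≤* sums c α
sums-antitone-move c (suc x ∷ y ∷ α) zero⋖one z<s
  rewrite +-suc c x | +-suc (c + x) y = n≤1+n _ ∷ ≤*-refl
sums-antitone-move c (x ∷ α) (suc⋖suc q) p = ≤-refl ∷ sums-antitone-move (c + x) α q p

sums-antitone : ∀ c → α ↘ β → sums c β ≤* sums c α
sums-antitone {α = α} c (drop {j} p) = sums-mono ≤-refl (updateAt-pred-≤* α j)
sums-antitone {α = α} c (move q p)   = sums-antitone-move c α q p

↘*-drop : ∀ k (α : Cell d) → x + k ∷ α ↘* x ∷ α
↘*-drop {x = x} zero    α rewrite +-identityʳ x = ε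
↘*-drop {x = x} (suc k) α rewrite +-suc x k = drop {j = zero} z<s ◅ ↘*-drop k α

↘*-move : ∀ x y k (α : Cell d) → x + k ∷ y ∷ α ↘* x ∷ y + k ∷ α
↘*-move x y zero    α rewrite +-identityʳ x | +-identityʳ y = ε
↘*-move x y (suc k) α rewrite +-suc x k | +-suc y k = move zero⋖one z<s ◅ ↘*-move x (suc y) k α

updateAt-↘* : (α : Cell d) {i j : Fin d} → i ⋖ j → ∀ k →
              updateAt α i (_+ k) ↘* updateAt α j (_+ k)
updateAt-↘* (x ∷ y ∷ α) zero⋖one    k = ↘*-move x y k α
updateAt-↘* (x ∷ α)     (suc⋖suc q) k = ↘*-cons x (updateAt-↘* α q k)

-- Converse of `sums-antitone`, greedily from the left: the surplus `k` of the first entry moves to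
-- the next one, which preserves all later partial sums; the surplus of the last entry is dropped.
sums-≤*⇒↘* : ∀ c (α β : Cell d) → sums c β ≤* sums c α → α ↘* β
sums-≤*⇒↘* c [] [] [] = ε
sums-≤*⇒↘* c (x ∷ α) (y ∷ β) (p ∷ ps) with m≤n⇒∃[o]m+o≡n (+-cancelˡ-≤ c y x p)
sums-≤*⇒↘* c (_ ∷ [])     (y ∷ [])     (p ∷ ps) | k , refl = ↘*-drop k []
sums-≤*⇒↘* c (_ ∷ x′ ∷ α) (y ∷ y′ ∷ β) (p ∷ ps) | k , refl =
  ↘*-move y x′ k α ◅◅
  ↘*-cons y (sums-≤*⇒↘* (c + y) (x′ + k ∷ α) (y′ ∷ β)
    (subst (sums (c + y) (y′ ∷ β) ≤*_) (sums-shift c y x′ k α) ps))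

-- Moving everything in front of the i-th entry into it produces a cell whose
-- i-th entry is the i-th partial sum.
All-<-sums : (α : Cell d) → (∀ {β} → α ↘* β → All (_< m) β) → All (_< m) (sums 0 α)
All-<-sums []           h = []
All-<-sums (x ∷ [])     h = h ε
All-<-sums {m = m} (x ∷ y ∷ α) h =
  All.head (h ε) ∷
  subst (All (_< m)) (sym (sums-shift 0 0 y x α))
    (All-<-sums (y + x ∷ α) λ r → All.tail (h (↘*-move 0 y x α ◅◅ ↘*-cons 0 r)))

BorelClosed : Pred (Cell d) 0ℓ → Set
BorelClosed Q = ∀ {α β} → α ↘ β → Q α → Q β

borelClosed* : {Q : Pred (Cell d) 0ℓ} → BorelClosed Q → α ↘* β → Q α → Q β
borelClosed* bc ε       q = q
borelClosed* bc (r ◅ s) q = borelClosed* bc s (bc r q)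

-- Strong stability

linked⇒⋖ : {H : Cell d} {i j : Fin d} → Linked _≤_ H → i ⋖ j → lookup H i ≤ lookup H j
linked⇒⋖ {H = x ∷ y ∷ _} (p ∷ s) zero⋖one    = p
linked⇒⋖ {H = x ∷ y ∷ _} (p ∷ s) (suc⋖suc q) = linked⇒⋖ s q

⋖⇒linked : (H : Cell d) → (∀ {i j} → i ⋖ j → lookup H i ≤ lookup H j) → Linked _≤_ H
⋖⇒linked []          h = []
⋖⇒linked (x ∷ [])    h = [-]
⋖⇒linked (x ∷ y ∷ H) h = h zero⋖one ∷ ⋖⇒linked (y ∷ H) (h ∘ suc⋖suc)

∈ₚ-≤* : (P : Partition d) → α ≤* β → β ∈ₚ P → α ∈ₚ P
∈ₚ-≤* P = downClosed-≤* (_∈ₚ P) (downClosed P)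

stable⇒borel : (P : Partition d) → StronglyStable P → BorelClosed (_∈ₚ P)
stable⇒borel P stable (drop {j} p) α∈P = downClosed P α∈P j p
stable⇒borel P stable {α} (move {i} {j} i⋖j p) α∈P =
  -- The target is `δ` raised by one at `j`. It lies below `δ` raised by its whole `j`-th arm, which
  -- is in `P`.
  ∈ₚ-≤* P (updateAt-mono-≤* δ j (≤-trans (≤-reflexive (+-comm 1 _)) (+-monoʳ-≤ (lookup δ j) 1≤hⱼ)))
        (proj₁ (hook j))
  where
  δ = updateAt α i pred
  δ∈P : δ ∈ₚ P
  δ∈P = downClosed P α∈P i p
  H = proj₁ (stable δ∈P)
  hook = proj₁ (proj₂ (stable δ∈P))
  δ+eᵢ≡α : updateAt δ i (_+ 1) ≡ α
  δ+eᵢ≡α = trans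
    (updateAt-updateAt-local i {h = id} α (trans (+-comm _ 1) (suc-pred (lookup α i) {{>-nonZero p}})))
    (updateAt-id-local i α refl)
  1≤hⱼ : 1 ≤ lookup H j
  1≤hⱼ = ≤-trans (proj₂ (hook i) 1 (subst (_∈ₚ P) (sym δ+eᵢ≡α) α∈P))
                 (linked⇒⋖ (proj₂ (proj₂ (stable δ∈P))) i⋖j)

-- Downward search from the bound `N`, ending at `0` at the latest. It yields arm lengths.
maximum : {Q : Pred ℕ 0ℓ} → Decidable Q → Q 0 → ∀ N → (∀ k → Q k → k ≤ N) →
          ∃ λ h → Q h × (∀ k → Q k → k ≤ h)
maximum Q? q₀ zero    b = 0 , q₀ , b
maximum Q? q₀ (suc N) b with Q? (suc N)
... | yes q = suc N , q , b
... | no ¬q = maximum Q? q₀ N λ k q → ≤-pred (≤∧≢⇒< (b k q) λ { refl → ¬q q })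

All-<-bound : (α : Cell d) → ∃ λ N → Box N α
All-<-bound []      = 0 , []
All-<-bound (x ∷ α) with All-<-bound α
... | N , b = suc x ⊔ N , m≤m⊔n (suc x) N ∷ All.map (λ q → ≤-trans q (m≤n⊔m (suc x) N)) b

fits : (P : Partition d) → ∃ (P FitsIn_)
fits {d} P = go (cells P)
  where
  go : (αs : List (Cell d)) → ∃ λ N → ∀ {α} → α ∈ αs → Box N α
  go List.[]       = 0 , λ ()
  go (α List.∷ αs) with All-<-bound α | go αs
  ... | M , b | N , bs = M ⊔ N , λ
    { (here refl) → All.map (λ q → ≤-trans q (m≤m⊔n M N)) b
    ; (there α∈)  → All.map (λ q → ≤-trans q (m≤n⊔m M N)) (bs α∈) }

module _ {d : ℕ} where
  open import Data.List.Membership.DecPropositional (≡-dec {n = d} _≟_) public using (_∈?_)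

arm : (P : Partition d) {α : Cell d} → α ∈ₚ P → (j : Fin d) → ∃ (IsArmLength P α j)
arm P {α} α∈P j = maximum (λ k → updateAt α j (_+ k) ∈? cells P)
  (subst (_∈ₚ P) (sym (updateAt-id-local j α (+-identityʳ _))) α∈P)
  (proj₁ (fits P))
  -- The raised entry is at least `k` and stays below the side of a box containing `P`.
  λ k q → ≤-trans (m≤n+m k (lookup α j)) (<⇒≤
    (subst (_< _) (lookup∘updateAt j α) (All.lookup⁺ (proj₂ (fits P) q) j)))

borel⇒stable : (P : Partition d) → BorelClosed (_∈ₚ P) → StronglyStable P
borel⇒stable {d} P bc {α} α∈P = H , hook , ⋖⇒linked H mono
  where
  H = tabulate (proj₁ ∘ arm P α∈P)
  hook : IsHookVector P α H
  hook j = subst (IsArmLength P α j) (sym (lookup∘tabulate _ j)) (proj₂ (arm P α∈P j))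
  mono : ∀ {i j} → i ⋖ j → lookup H i ≤ lookup H j
  mono {i} {j} i⋖j =
    proj₂ (hook j) _ (borelClosed* bc (updateAt-↘* α i⋖j _) (proj₁ (hook i)))

-- The correspondence

open Equivalence using (to; from)

box : ∀ d → ℕ → List (Cell d)
box zero    N = [] List.∷ List.[]
box (suc d) N = cartesianProductWith _∷_ (upTo N) (box d N)

∈-box : All (_< m) α → α ∈ box d m
∈-box []       = here refl
∈-box (p ∷ ps) = ∈-cartesianProductWith⁺ _∷_ (∈-upTo⁺ p) (∈-box ps)

-- Filter the finite box of side `N`; by the bound no cell of `Q` is lost.
comprehension : {Q : Pred (Cell d) 0ℓ} → Decidable Q → DownClosed Q → ∀ N →
                (∀ {α} → Q α → Box N α) →
                Σ[ P ∈ Partition d ] (∀ {α} → α ∈ₚ P ⇔ Q α)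
comprehension {d} {Q} Q? dc N bound = P , mk⇔ sound complete
  where
  sound : ∀ {α} → α ∈ filter Q? (box d N) → Q α
  sound = proj₂ ∘ ∈-filter⁻ Q? {xs = box d N}
  complete : ∀ {α} → Q α → α ∈ filter Q? (box d N)
  complete q = ∈-filter⁺ Q? (∈-box (bound q)) q
  P : Partition d
  P = record { cells = filter Q? (box d N) ; downClosed = λ α∈ j p → complete (dc (sound α∈) j p) }

-- Membership in the symmetric partition that corresponds to `P`; `BorelCell` below describes the
-- inverse.
SymCell : Partition d → Pred (Cell d) 0ℓ
SymCell P α = diffs 0 (sort α) ∈ₚ P

BorelCell : Partition d → Pred (Cell d) 0ℓ
BorelCell T β = sums 0 β ∈ₚ T

sums-diffs-sort : (α : Cell d) → sums 0 (diffs 0 (sort α)) ≡ sort α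
sums-diffs-sort α = sums∘diffs (sort α) (sort-sorted α)

diffs-sort-sums : (β : Cell d) → diffs 0 (sort (sums 0 β)) ≡ β
diffs-sort-sums β = trans (cong (diffs 0) (sort∘sums 0 β)) (diffs∘sums 0 β)

-- Lowering an entry lowers the sorted cell entrywise, so Borel moves lead from the old differences
-- to the new ones.
symCell-downClosed : (P : Partition d) → StronglyStable P → DownClosed (SymCell P)
symCell-downClosed P stable {α} α∈ j p = borelClosed* (stable⇒borel P stable)
  (sums-≤*⇒↘* 0 _ _
    (subst₂ _≤*_ (sym (sums-diffs-sort (updateAt α j pred))) (sym (sums-diffs-sort α))
      (sort-mono (updateAt-pred-≤* α j))))
  α∈

symCell-bound : (P : Partition d) → StronglyStable P → P FitsIn m → SymCell P α → Box m α
symCell-bound {m = m} {α = α} P stable fit α∈ = All-↭ (↭-sym (↭-sort α))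
  (subst (All (_< m)) (sums-diffs-sort α)
    (All-<-sums _ λ r → fit (borelClosed* (stable⇒borel P stable) r α∈)))

stabilize : (T : Partition d) → Σ[ P ∈ Partition d ] (∀ {β} → β ∈ₚ P ⇔ BorelCell T β)
stabilize T = comprehension (λ β → sums 0 β ∈? cells T)
  (λ {β} β∈ j p → ∈ₚ-≤* T (sums-mono ≤-refl (updateAt-pred-≤* β j)) β∈)
  (proj₁ (fits T)) (λ β∈ → All-<-≤* (≤*-sums 0 _) (proj₂ (fits T) β∈))

infix 4 _∼_

-- The graph of the bijection. Stability of `P`, symmetry of `T` and equality of minimal boxes are
-- all derived from this relation.
record _∼_ (P T : Partition d) : Set where
  constructor mk∼
  field
    ∈⇔symCell : α ∈ₚ T ⇔ SymCell P α

open _∼_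

symmetrize : ((P , _) : Σ[ P ∈ Partition d ] StronglyStable P) → ∃ (P ∼_)
symmetrize (P , stable) = map₂ mk∼ $ comprehension (λ α → diffs 0 (sort α) ∈? cells P)
  (λ {α} → symCell-downClosed P stable {α}) (proj₁ (fits P)) (symCell-bound P stable (proj₂ (fits P)))

module _ {d : ℕ} where
  open Setoid (Partitionₛ d) public using (_≈_)

module _ {P T : Partition d} (P∼T : P ∼ T) where

  -- The relation read from the side of `P`: `sums 0 β` is already sorted and has differences `β`.
  ∈⇔sums∈ : β ∈ₚ P ⇔ sums 0 β ∈ₚ T
  ∈⇔sums∈ {β} = mk⇔
    (λ β∈P → from (∈⇔symCell P∼T) (subst (_∈ₚ P) (sym (diffs-sort-sums β)) β∈P))
    (λ β∈T → subst (_∈ₚ P) (diffs-sort-sums β) (to (∈⇔symCell P∼T) β∈T))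

  ∼⇒symmetric : TotallySymmetric T
  ∼⇒symmetric {α} α∈T π =
    from (∈⇔symCell P∼T) (subst (λ β → diffs 0 β ∈ₚ P) (sym (sort-permute π α)) (to (∈⇔symCell P∼T) α∈T))

  ∼⇒stable : StronglyStable P
  ∼⇒stable = borel⇒stable P λ r α∈P →
    from ∈⇔sums∈ (∈ₚ-≤* T (sums-antitone 0 r) (to ∈⇔sums∈ α∈P))

  fitsIn⁺ : P FitsIn m → T FitsIn m
  fitsIn⁺ fit α∈T = symCell-bound P ∼⇒stable fit (to (∈⇔symCell P∼T) α∈T)

  fitsIn⁻ : T FitsIn m → P FitsIn m
  fitsIn⁻ fit β∈P = All-<-≤* (≤*-sums 0 _) (fit (to ∈⇔sums∈ β∈P))

  minimalBox⁺ : MinimalBox n P → MinimalBox n T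
  minimalBox⁺ (fit , min) = fitsIn⁺ fit , λ m → min m ∘ fitsIn⁻

  minimalBox⁻ : MinimalBox n T → MinimalBox n P
  minimalBox⁻ (fit , min) = fitsIn⁻ fit , λ m → min m ∘ fitsIn⁺

module _ {P P′ T T′ : Partition d} (P∼T : P ∼ T) (P′∼T′ : P′ ∼ T′) where

  ∼-functional : P ≈ P′ → T ≈ T′
  ∼-functional P≈P′ = mk⇔ (from (∈⇔symCell P′∼T′) ∘ to P≈P′ ∘ to (∈⇔symCell P∼T)) (from (∈⇔symCell P∼T) ∘ from P≈P′ ∘ to (∈⇔symCell P′∼T′))

  ∼-injective : T ≈ T′ → P ≈ P′
  ∼-injective T≈T′ = mk⇔
    (from (∈⇔sums∈ P′∼T′) ∘ to T≈T′ ∘ to (∈⇔sums∈ P∼T))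
    (from (∈⇔sums∈ P∼T) ∘ from T≈T′ ∘ to (∈⇔sums∈ P′∼T′))

∼-surjective : (T : Partition d) → TotallySymmetric T → ∃ (_∼ T)
∼-surjective T symmetric = P , mk∼ λ {α} → mk⇔
  (λ α∈T → from spec (subst (_∈ₚ T) (sym (sums-diffs-sort α)) (↭-closed (↭-sort α) α∈T)))
  (λ α∈P → ↭-closed (↭-sym (↭-sort α)) (subst (_∈ₚ T) (sums-diffs-sort α) (to spec α∈P)))
  where
  P = proj₁ (stabilize T)
  spec : ∀ {β} → β ∈ₚ P ⇔ BorelCell T β
  spec = proj₂ (stabilize T)
  ↭-closed : α ↭ β → α ∈ₚ T → β ∈ₚ T
  ↭-closed (π , refl) α∈T = symmetric α∈T π

-- Stated for subclasses `Q` and `R` matched by `_∼_`, so that one construction gives both the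
-- global bijection and its restriction to each side length.
∼-bijection : {Q R : Pred (Partition d) 0ℓ} →
              (∀ {P} → Q P → StronglyStable P) → (∀ {T} → R T → TotallySymmetric T) →
              (∀ {P T} → P ∼ T → Q P → R T) → (∀ {P T} → P ∼ T → R T → Q P) →
              Bijection (subsetoid Q) (subsetoid R)
∼-bijection {Q = Q} {R} stable symmetric Q⇒R R⇒Q = record
  { to        = λ (P , q) → image q , Q⇒R (∼-image q) q
  ; cong      = λ {(_ , q)} {(_ , q′)} → ∼-functional (∼-image q) (∼-image q′)
  ; bijective = (λ {(_ , q)} {(_ , q′)} → ∼-injective (∼-image q) (∼-image q′))
              , λ (T , r) → let P , P∼T = ∼-surjective T (symmetric r) in
                  (P , R⇒Q P∼T r) , λ {(_ , q)} → ∼-functional (∼-image q) P∼T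
  }
  where
  image : ∀ {P} → Q P → Partition _
  image q = proj₁ (symmetrize (_ , stable q))
  ∼-image : ∀ {P} (q : Q P) → P ∼ image q
  ∼-image q = proj₂ (symmetrize (_ , stable q))

theorem1 : (d : ℕ) .{{_ : NonZero d}} →
    Σ[ f ∈ Bijection (StronglyStableₛ d) (TotallySymmetricₛ d) ]
    ((n : ℕ) →
    Σ[ g ∈ Bijection (B̃ d n) (T̃ d n) ]
    ((P : Setoid.Carrier (B̃ d n)) →
    Setoid._≈_ (Partitionₛ d)
    (proj₁ (Bijection.to g P))
    (proj₁ (Bijection.to f (map₂ proj₁ P)))))
theorem1 d =
    ∼-bijection id id (λ P∼T _ → ∼⇒symmetric P∼T) (λ P∼T _ → ∼⇒stable P∼T)
  , λ n →
      ∼-bijection proj₁ proj₁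
        (λ P∼T (_ , box) → ∼⇒symmetric P∼T , minimalBox⁺ P∼T box)
        (λ P∼T (_ , box) → ∼⇒stable P∼T , minimalBox⁻ P∼T box)
    -- Both bijections apply `symmetrize` to the same stable partition, so the images have the same
    -- cells by definition.
    , λ _ → mk⇔ id id
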